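{- Let $\mathcal N=\langle P,T,F,V,guard\rangle$ be a data Petri net (with real-valued variables, initial state $(M_I,\alpha_I)$ and final marking $M_F$). Let $\mathcal N_{Rep}$ be a repaired data Petri net obtained by executing the procedure RepairDPN on $\mathcal N$. Then the reachability graph $RG_{\mathcal N_{Rep}}$ is a subgraph of the reachability graph $RG_{\mathcal N}$.
   Context: **Constraints.** For a set $X$ of variables, $\Phi(X)$ is the set of arithmetic constraints $\varphi ::= \top \mid x\odot y\mid x\odot c\mid \neg\varphi\mid\varphi_1\wedge\varphi_2$ with $x,y\in X$, $c\in\mathbb R$, $\odot\in\{<,=,>\}$, with the usual satisfaction relation $\theta\models\varphi$ for assignments $\theta:X\to\mathbb R$. **Data Petri net (DPN).** A tuple $\mathcal N=\langle P,T,F,V,guard\rangle$ with $P,T$ disjoint sets of places and transitions (finite), $F:(P\times T)\cup(T\times P)\to\mathbb N$, $V$ a finite set of real-valued variables, and $guard:T\to\Phi(V^r\cup V^w)$, where $V^r=\{v^r\mid v\in V\}$ and $V^w=\{v^w\mid v\in V\}$ denote input and output values of variables. $write(t)$ is the set of variables of $V^w$ occurring in $guard(t)$. A marking is $M:P\to\mathbb N$; a valuation is $\alpha:V\to\mathbb R$; a state is a pair $(M,\alpha)$. $M\prec M'$ means $M(p)\le M'(p)$ for all $p$ with strict inequality for some $p$. **Firing, reachability graph.** $(M,\alpha)[t\rangle(M',\alpha')$ iff $M(p)\ge F(p,t)$ and $M'(p)=M(p)-F(p,t)+F(t,p)$ for all $p$; the assignment $\beta$ with $\beta(v^r)=\alpha(v)$,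 $\beta(v^w)=\alpha'(v)$ satisfies $guard(t)$; and $\alpha'(v)=\alpha(v)$ whenever $v^w\notin write(t)$. $Reach_{\mathcal N}$ is the smallest set of states containing $(M_I,\alpha_I)$ and closed under firing. The reachability graph $RG_{\mathcal N}$ has node set $Reach_{\mathcal N}$ and an edge $(v,t,v')$ iff $v[t\rangle v'$. A transition is dead if it fires at no reachable state. When places are removed (only isolated places are), a marking of the smaller net is identified with the marking of the original net that has the initial number of tokens $M_I(p)$ in each removed place $p$. **Induced labeled transition system.** $LTS_{\mathcal N}=\langle S,E,s_0\rangle$ has as nodes pairs $(M,A)$, with $M$ a marking and $A$ a set of valuations, generated from the initial node $s_0=(M_I,\{\alpha_I\})$ by the arc rule: $(M,A)\xrightarrow{t}(M',A')$ iff $M(p)\ge F(p,t)$ and $M'(p)=M(p)-F(p,t)+F(t,p)$ for all $p$, and $A'=\{\alpha'\mid \exists\alpha\in A: (M,\alpha)[t\rangle(M',\alpha')\}\neq\emptyset$. Each set $A$ is represented symbolically by a constraint $\phi\in\Phi(V)$ (the constraint of the node) whose satisfying assignments are exactly the elements of $A$. **Coverability graph.** $(M,A)\sqsubset(M',A')$ iff $A=A'$ and $M\prec M'$. The coverability graph of $LTS_{\mathcal N}$ is $\langle S_{CG},E_{CG},s_0\rangle$, where $S_{CG}\subseteq S$ is the set of non-isolated nodes; $s'\in S_{CG}$ is dead if it has no successors in $LTS_{\mathcal N}$ or there is $s\in S_{CG}$ along the path from $s_0$ to $s'$ with $s\sqsubset s'$, and live otherwise; $(s,t,s')\in E_{CG}$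 iff $(s,t,s')\in E$ and $s$ is live or is the initial node. Background fact recalled in the paper from earlier work: this graph is finite and effectively constructible. **Colored coverability graph (CCG).** The coverability graph enriched with $c:S_{CG}\to\{\mathtt{red},\mathtt{green}\}$, where, for $s=(M,A)$, $c(s)=\mathtt{green}$ if $M=M_F$ or $s$ has a path to a green node; otherwise $c(s)=\mathtt{red}$. **Refined DPN $\mathcal N_R$.** The input condition of a transition $t$ is $\exists\, write(t): guard(t)$ (equivalent to a quantifier-free constraint over $V^r$). For every cycle of $LTS_{\mathcal N}$, every transition $t$ in the cycle with $write(t)\ne\emptyset$ and every transition $t_{out}$ leading out of the cycle, $t$ is split into $t^+$ and $t^-$ (with the same incoming and outgoing arcs as $t$), where $guard(t^+)$ is the conjunction of $guard(t)$ with the input condition of $t_{out}$, and $guard(t^-)$ is the conjunction of $guard(t)$ with the negation of that input condition; here the variables of the input condition of $t_{out}$ stand for the values after $t$ fires, i.e. $v$ is read as $v^w$ if $v^w\in write(t)$ and as $v^r$ otherwise. This is iterated until none of the transitions change. Background fact recalled in the paper from earlier work: for bounded DPNs (those with a uniform bound on the number of tokens in every place over all reachable states) this construction terminates, and $\mathcal N_R$ is behaviorally equivalent to $\mathcal N$. **$\tau$-DPN $\mathcal N_\tau$.** Obtained from $\mathcal N$ by adding, for each $t\in T$ whose guard contains non-trivial input constraints (constraints including variables from $V^r$), a transition $\tau_t$ with guard $\neg(\exists\, write(t): guard(t))$, which requires the same tokens as $t$ and leaves the marking unchanged: $F(p,\tau_t)=F(\tau_t,p)=F(p,t)$ for all $p$.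 $\mathcal N_{R_\tau}$ denotes the $\tau$-DPN of the refined DPN $\mathcal N_R$. **Procedure MakeRepairStep.** Input: a DPN and its CCG; let $T_\tau$ be its (possibly empty) set of $\tau$-transitions. An arc is critical if its source is green and its target is red. For each critical arc $(s,t,s')$, where $\phi'$ is the constraint of $s'$: (1) if $t\notin T_\tau$, replace $guard(t)$ by its conjunction with $\neg\phi'$; (2) if $t\in T_\tau$, consider all simple paths in the CCG leading to $s$, for each take its last arc $(s'',t',s''')$ with $t'\notin T_\tau$, and for each $t'$ so obtained replace $guard(t')$ by its conjunction with $\neg\phi'$. In every restricted guard of a transition $u$, each variable $v$ of an added constraint is replaced by $v^w$ if $v^w\in write(u)$ and by $v^r$ otherwise. Output: the DPN with the modified guards. **Procedure RepairDPN.** Input: a DPN $\mathcal N$ with $(M_I,\alpha_I)$ and $M_F$. Output: a pair (net, $isSuccess$). 1. Construct the CCG of $\mathcal N$ and replace $\mathcal N$ by the result of MakeRepairStep on it. 2. Loop: construct $\mathcal N_{R_\tau}$ for the current net $\mathcal N$, and its CCG. If the CCG contains both green and red nodes, apply MakeRepairStep to $\mathcal N_{R_\tau}$ and its CCG, let the resulting net without the $\tau$-transitions be the new current net, and repeat. If all nodes are green, set $isSuccess=\mathrm{true}$ and go to step 3. If all nodes are red, set $isSuccess=\mathrm{false}$, stop and return the source net. 3. Remove dead transitions (using information from the CCG) and isolated places, merge back the transitions obtained by splitting one transition $t$ in step 2 into a single transition $t$ whose guard is the disjunction of their guards, and return the modified net. -}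

module Defs where

open import Data.Bool.Base using (Bool; true; false; if_then_else_)
open import Data.Fin.Base using (Fin; _↑ˡ_; _↑ʳ_; splitAt)
import Data.Fin.Properties as Fin
open import Data.Fin.Subset using (Subset) renaming (_∈_ to _∈ˢ_)
open import Data.Integer.Base using (+_)
open import Data.List.Base as List
  using (List; []; _∷_; _++_; allFin; concatMap; filter; foldl; length; lookup)
open import Data.List.Membership.Propositional using (_∈_)
import Data.List.Membership.DecPropositional as DecMembership
open import Data.List.Relation.Unary.All using (All)
open import Data.List.Relation.Unary.AllPairs using (AllPairs)
open import Data.List.Relation.Unary.Unique.Propositional using (Unique)
open import Data.Nat.Base as ℕ using (ℕ; suc)
open import Data.Product.Base using (Σ; ∃; ∃₂; _×_; _,_; proj₁; proj₂)
open import Data.Rational.Base as ℚ using (ℚ)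
open import Data.Sum.Base using (_⊎_; inj₁; inj₂; [_,_])
import Data.Sum.Properties as Sum
open import Data.Unit.Base using (⊤)
open import Function.Base using (id; _∘_)
open import Function.Bundles using (_⇔_; _↣_; Injection)
open import Function.Construct.Identity using (↣-id)
open import Level using (Level; 0ℓ; _⊔_) renaming (suc to lsuc)
open import Relation.Binary.Core using (Rel)
open import Relation.Binary.Definitions using (DecidableEquality)
open import Relation.Binary.PropositionalEquality.Core using (_≡_; _≢_)
open import Relation.Nullary.Decidable.Core using (Dec; yes; no; does)
open import Relation.Nullary.Negation.Core using (¬_)
open import Relation.Unary using (Pred; Satisfiable; _≐_; ∅)

1/1+_ : ℕ → ℚ
1/1+ n = (+ 1) ℚ./ suc n

-- Regular Cauchy sequences; the n-th term is within 1/(1+n) of the limit.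
record ℝ : Set where
  field
    approx  : ℕ → ℚ
    regular : ∀ m n → ℚ.∣ approx m ℚ.- approx n ∣ ℚ.≤ (1/1+ m) ℚ.+ (1/1+ n)

open ℝ public

infix 4 _≤ᴿ_ _<ᴿ_ _≈ᴿ_

_≤ᴿ_ _<ᴿ_ _≈ᴿ_ : Rel ℝ 0ℓ
x ≤ᴿ y = ∀ n → approx x n ℚ.≤ approx y n ℚ.+ ((1/1+ n) ℚ.+ (1/1+ n))
-- This is the classical strict order; unlike "bounded apart by a positive
-- rational", it is stable under double negation without Markov's principle.
x <ᴿ y = ¬ (y ≤ᴿ x)
x ≈ᴿ y = x ≤ᴿ y × y ≤ᴿ x

data Comparison : Set where
  lt eq gt : Comparison

⟦_⟧ᶜ : Comparison → Rel ℝ 0ℓ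
⟦ lt ⟧ᶜ x y = x <ᴿ y
⟦ eq ⟧ᶜ x y = x ≈ᴿ y
⟦ gt ⟧ᶜ x y = y <ᴿ x

infixl 6 _∧′_ _∨′_
infix  7 ¬′_

data Φ (X : Set) : Set where
  ⊤′    : Φ X
  var   : X → Comparison → X → Φ X
  const : X → Comparison → ℝ → Φ X
  ¬′_   : Φ X → Φ X
  _∧′_  : Φ X → Φ X → Φ X

private variable
  X Y : Set

_∨′_ : Φ X → Φ X → Φ X
φ ∨′ ψ = ¬′ (¬′ φ ∧′ ¬′ ψ)

⋁ : List (Φ X) → Φ X
⋁ []           = ¬′ ⊤′
⋁ (φ ∷ [])     = φ
⋁ (φ ∷ ψ ∷ φs) = φ ∨′ ⋁ (ψ ∷ φs)

infix 4 _⊨_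

_⊨_ : (X → ℝ) → Φ X → Set
θ ⊨ ⊤′          = ⊤
θ ⊨ var x ⊙ y   = ⟦ ⊙ ⟧ᶜ (θ x) (θ y)
θ ⊨ const x ⊙ c = ⟦ ⊙ ⟧ᶜ (θ x) c
θ ⊨ ¬′ φ        = ¬ (θ ⊨ φ)
θ ⊨ φ ∧′ ψ      = θ ⊨ φ × θ ⊨ ψ

Sat : Φ X → Set
Sat φ = ∃ λ θ → θ ⊨ φ

vars : Φ X → List X
vars ⊤′            = []
vars (var x _ y)   = x ∷ y ∷ []
vars (const x _ _) = x ∷ []
vars (¬′ φ)        = vars φ
vars (φ ∧′ ψ)      = vars φ ++ vars ψ

rename : (X → Y) → Φ X → Φ Y
rename f ⊤′            = ⊤′
rename f (var x ⊙ y)   = var (f x) ⊙ (f y)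
rename f (const x ⊙ c) = const (f x) ⊙ c
rename f (¬′ φ)        = ¬′ rename f φ
rename f (φ ∧′ ψ)      = rename f φ ∧′ rename f ψ

-- V^r ∪ V^w, for the variables V = Fin V
RW : ℕ → Set
RW V = Fin V ⊎ Fin V

pattern _ʳ v = inj₁ v
pattern _ʷ v = inj₂ v

_≟ᴿᵂ_ : ∀ {V} → DecidableEquality (RW V)
_≟ᴿᵂ_ = Sum.≡-dec Fin._≟_ Fin._≟_

Guard : ℕ → Set
Guard V = Φ (RW V)

Marking Valuation : ℕ → Set
Marking P   = Fin P → ℕ
Valuation V = Fin V → ℝ

infix 4 _≗ᴹ_ _≈ⱽ_ _≺_

_≗ᴹ_ _≺_ : ∀ {P} → Rel (Marking P) 0ℓ
M ≗ᴹ M′ = ∀ p → M p ≡ M′ p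
M ≺ M′  = (∀ p → M p ℕ.≤ M′ p) × (∃ λ p → M p ℕ.< M′ p)

_≈ⱽ_ : ∀ {V} → Rel (Valuation V) 0ℓ
α ≈ⱽ α′ = ∀ v → α v ≈ᴿ α′ v

-- P, T, V are the numbers of places, transitions and variables.
-- F⁻ p t is F(p,t) and F⁺ p t is F(t,p).
record DPN (P T V : ℕ) : Set where
  field
    F⁻ F⁺ : Fin P → Fin T → ℕ
    guard : Fin T → Guard V
    M-I   : Marking P
    α-I   : Valuation V
    M-F   : Marking P

private variable
  P T V : ℕ

State : ℕ → ℕ → Set
State P V = Marking P × Valuation V

module _ (N : DPN P T V) where
  open DPN N

  Writes : Fin T → Fin V → Set
  Writes t v = v ʷ ∈ vars (guard t)

  Reads : Fin T → Fin V → Set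
  Reads t v = v ʳ ∈ vars (guard t)

  writes? : ∀ t v → Dec (Writes t v)
  writes? t v = DecMembership._∈?_ _≟ᴿᵂ_ (v ʷ) (vars (guard t))

  reads? : ∀ t v → Dec (Reads t v)
  reads? t v = DecMembership._∈?_ _≟ᴿᵂ_ (v ʳ) (vars (guard t))

  -- The copy of v that holds its value after t has fired.
  after : Fin T → Fin V → RW V
  after t v = if does (writes? t v) then v ʷ else v ʳ

  Moves : Marking P → Fin T → Marking P → Set
  Moves M t M′ = (∀ p → F⁻ p t ℕ.≤ M p) × (∀ p → M′ p ≡ M p ℕ.∸ F⁻ p t ℕ.+ F⁺ p t)

  Fires : State P V → Fin T → State P V → Set
  Fires (M , α) t (M′ , α′) =
      Moves M t M′
    × [ α , α′ ] ⊨ guard t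
    × (∀ v → ¬ Writes t v → α′ v ≈ᴿ α v)

  -- Markings and valuations are functions, so the initial state is only
  -- determined up to pointwise equality; Fires respects that equality.
  data Reach : Pred (State P V) 0ℓ where
    initial : ∀ {M α} → M ≗ᴹ M-I → α ≈ⱽ α-I → Reach (M , α)
    fire    : ∀ {s t s′} → Reach s → Fires s t s′ → Reach s′

  DeadTransition : Fin T → Set
  DeadTransition t = ¬ (∃₂ λ s s′ → Reach s × Fires s t s′)

  -- χ is a quantifier-free form of ∃ write(t) : guard(t).
  IsInputCondition : Fin T → Φ (Fin V) → Set
  IsInputCondition t χ = ∀ (θ : RW V → ℝ) →
    ((λ v → θ (v ʳ)) ⊨ χ) ⇔
    (∃ λ (θ′ : RW V → ℝ) → (∀ v → θ′ (v ʳ) ≈ᴿ θ (v ʳ))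
                         × (∀ v → ¬ Writes t v → θ′ (v ʷ) ≈ᴿ θ (v ʷ))
                         × θ′ ⊨ guard t)

record Graph (S L : Set) : Set₁ where
  field
    Nodes : Pred S 0ℓ
    Edges : S → L → S → Set

-- G is a subgraph of H once nodes and labels are identified along f and g.
record SubgraphVia {S S′ L L′ : Set} (f : S → S′) (g : L → L′)
                   (G : Graph S L) (H : Graph S′ L′) : Set where
  field
    nodes⊆ : ∀ {s} → Graph.Nodes G s → Graph.Nodes H (f s)
    edges⊆ : ∀ {s l s′} → Graph.Edges G s l s′ → Graph.Edges H (f s) (g l) (f s′)

RG : DPN P T V → Graph (State P V) (Fin T)
RG N = record
  { Nodes = Reach N
  ; Edges = λ s t s′ → Reach N s × Reach N s′ × Fires N s t s′
  }

module _ {a ℓ} {S : Set a} {L : Set} (_⟶⟨_⟩_ : S → L → S → Set ℓ) where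

  data Walk : S → S → Set (a ⊔ ℓ) where
    []  : ∀ {s} → Walk s s
    _∷_ : ∀ {s l s′ s″} → s ⟶⟨ l ⟩ s′ → Walk s′ s″ → Walk s s″

module _ {a ℓ} {S : Set a} {L : Set} {_⟶⟨_⟩_ : S → L → S → Set ℓ} where

  labels : ∀ {s s′} → Walk _⟶⟨_⟩_ s s′ → List L
  labels []            = []
  labels (_∷_ {l = l} _ w) = l ∷ labels w

  sources : ∀ {s s′} → Walk _⟶⟨_⟩_ s s′ → List S
  sources []                = []
  sources (_∷_ {s = s} _ w) = s ∷ sources w

  vertices : ∀ {s s′} → Walk _⟶⟨_⟩_ s s′ → List S
  vertices {s′ = s′} w = sources w ++ (s′ ∷ [])

Node : ℕ → ℕ → Set₁
Node P V = Marking P × Pred (Valuation V) 0ℓ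

infix 4 _≋_ _⊏_

_≋_ _⊏_ : Rel (Node P V) 0ℓ
(M , A) ≋ (M′ , A′) = M ≗ᴹ M′ × A ≐ A′
(M , A) ⊏ (M′ , A′) = A ≐ A′ × M ≺ M′

module _ (N : DPN P T V) where
  open DPN N

  s-I : Node P V
  s-I = M-I , (_≈ⱽ α-I)

  LTSArc : Node P V → Fin T → Node P V → Set
  LTSArc (M , A) t (M′ , A′) =
      Moves N M t M′
    × A′ ≐ (λ α′ → ∃ λ α → A α × Fires N (M , α) t (M′ , α′))
    × Satisfiable A′

  data LTSNode : Node P V → Set₁ where
    initial : ∀ {s} → s ≋ s-I → LTSNode s
    step    : ∀ {s t s′} → LTSNode s → LTSArc s t s′ → LTSNode s′

  record LTSCycle : Set₁ where
    field
      {start end} : Node P V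
      reachable   : LTSNode start
      walk        : Walk LTSArc start end
      closed      : start ≋ end
      simple      : AllPairs (λ s s′ → ¬ s ≋ s′) (sources walk)

  OnCycle : LTSCycle → Fin T → Set
  OnCycle C t = t ∈ labels (LTSCycle.walk C)

  LeavesCycle : LTSCycle → Fin T → Set₁
  LeavesCycle C t = ∃₂ λ s s′ →
    s ∈ sources walk × LTSArc s t s′ × All (λ r → ¬ r ≋ s′) (sources walk)
    where open LTSCycle C

-- The nodes of the graph are indexed by Fin size, one index for each node of
-- the LTS that is kept, its set of valuations being given by a constraint.
record CoverabilityGraph (N : DPN P T V) : Set₁ where
  field
    size       : ℕ
    s₀         : Fin size
    marking    : Fin size → Marking P
    constraint : Fin size → Φ (Fin V)
    live       : Subset size

  node : Fin size → Node P V
  node i = marking i , (_⊨ constraint i)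

  Expanded : Pred (Fin size) 0ℓ
  Expanded i = i ∈ˢ live ⊎ i ≡ s₀

  Arc : Fin size → Fin T → Fin size → Set
  Arc i t j = LTSArc N (node i) t (node j) × Expanded i

  field
    s₀-spec  : node s₀ ≋ s-I N
    distinct : ∀ {i j} → node i ≋ node j → i ≡ j
    complete : ∀ {i t s} → Expanded i → LTSArc N (node i) t s → ∃ λ j → node j ≋ s
    -- The path along which node i was first generated.  Its existence also
    -- says that every node is in the LTS and, unless initial, not isolated.
    path     : ∀ i → Walk Arc s₀ i

  Dead : Pred (Fin size) (lsuc 0ℓ)
  Dead i = (¬ ∃₂ λ t s → LTSArc N (node i) t s)
         ⊎ (∃ λ j → j ∈ vertices (path i) × node j ⊏ node i)

  field
    live-spec : ∀ i → i ∈ˢ live ⇔ (¬ Dead i)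

data Color : Set where
  red green : Color

module _ {N : DPN P T V} (G : CoverabilityGraph N) where
  open CoverabilityGraph G

  data Green : Pred (Fin size) 0ℓ where
    final : ∀ {i} → marking i ≗ᴹ DPN.M-F N → Green i
    step  : ∀ {i t j} → Arc i t j → Green j → Green i

record CCG (N : DPN P T V) : Set₁ where
  field
    graph : CoverabilityGraph N

  open CoverabilityGraph graph public

  field
    color      : Fin size → Color
    color-spec : ∀ i → color i ≡ green ⇔ Green graph i

  HasGreen HasRed AllGreen AllRed : Set
  HasGreen = ∃ λ i → color i ≡ green
  HasRed   = ∃ λ i → color i ≡ red
  AllGreen = ∀ i → color i ≡ green
  AllRed   = ∀ i → color i ≡ red

-- Each entry (t , g) becomes a copy of t with guard g.
variant : DPN P T V → (ts : List (Fin T × Guard V)) → DPN P (length ts) V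
variant N ts = record
  { F⁻    = λ p u → F⁻ p (proj₁ (lookup ts u))
  ; F⁺    = λ p u → F⁺ p (proj₁ (lookup ts u))
  ; guard = λ u → proj₂ (lookup ts u)
  ; M-I   = M-I
  ; α-I   = α-I
  ; M-F   = M-F
  } where open DPN N

module _ (N : DPN P T V) where
  open DPN N

  ToSplit : Fin T → Fin T → Set₁
  ToSplit t t-out = ∃ (Writes N t) ×
    (∃ λ C → OnCycle N C t × LeavesCycle N C t-out)

  -- Splitting of the transition t, whose current guard is g, by a list of input
  -- conditions.  When one of the two halves is unsatisfiable, the other half
  -- is equivalent to g and t does not change; otherwise the iteration of
  -- splittings would never stop.
  data Split (t : Fin T) : Guard V → List (Φ (Fin V)) → List (Guard V) → Set where
    []    : ∀ {g} → Split t g [] (g ∷ [])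
    split : ∀ {g χ χs gs⁺ gs⁻} →
            let g⁺ = g ∧′ rename (after N t) χ
                g⁻ = g ∧′ ¬′ rename (after N t) χ in
            Sat g⁺ → Sat g⁻ → Split t g⁺ χs gs⁺ → Split t g⁻ χs gs⁻ →
            Split t g (χ ∷ χs) (gs⁺ ++ gs⁻)
    keep  : ∀ {g χ χs gs} →
            let g⁺ = g ∧′ rename (after N t) χ
                g⁻ = g ∧′ ¬′ rename (after N t) χ in
            ¬ (Sat g⁺ × Sat g⁻) → Split t g χs gs →
            Split t g (χ ∷ χs) gs

  record RefinementPass : Set₁ where
    field
      inputs      : Fin T → Φ (Fin V)
      inputs-spec : ∀ t → IsInputCondition N t (inputs t)
      outs        : Fin T → List (Fin T)
      outs-spec   : ∀ t t-out → t-out ∈ outs t ⇔ ToSplit t t-out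
      guards      : Fin T → List (Guard V)
      guards-spec : ∀ t → Split t (guard t) (List.map inputs (outs t)) (guards t)

    copies : List (Fin T × Guard V)
    copies = concatMap (λ t → List.map (t ,_) (guards t)) (allFin T)

    refined : DPN P (length copies) V
    refined = variant N copies

    origin : Fin (length copies) → Fin T
    origin u = proj₁ (lookup copies u)

    Unchanged : Set
    Unchanged = ∀ t → guards t ≡ guard t ∷ []

-- Refinement N N-R o : N-R is a refined DPN of N whose transition u stems
-- from the transition o u of N.
data Refinement {P T V : ℕ} (N : DPN P T V) :
                ∀ {T′} → DPN P T′ V → (Fin T′ → Fin T) → Set₁ where
  done : (R : RefinementPass N) → RefinementPass.Unchanged R → Refinement N N id
  more : (R : RefinementPass N) → let open RefinementPass R in
         ∀ {T′} {N-R : DPN P T′ V} {o : Fin T′ → Fin (length copies)} →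
         ¬ Unchanged → Refinement refined N-R o → Refinement N N-R (origin ∘ o)

withInput : DPN P T V → List (Fin T)
withInput {T = T} N = filter (λ t → Fin.any? (reads? N t)) (allFin T)

#τ : DPN P T V → ℕ
#τ N = length (withInput N)

-- The transitions of N come first, followed by the τ-transitions; inputs t
-- is meant to be the input condition of t.
τ-DPN : (N : DPN P T V) → (Fin T → Φ (Fin V)) → DPN P (T ℕ.+ #τ N) V
τ-DPN {T = T} N inputs = record
  { F⁻    = λ p u → [ F⁻ p , F⁻ p ∘ lookup (withInput N) ] (splitAt T u)
  ; F⁺    = λ p u → [ F⁺ p , F⁻ p ∘ lookup (withInput N) ] (splitAt T u)
  ; guard = λ u → [ guard , (λ k → ¬′ rename _ʳ (inputs (lookup (withInput N) k))) ]
                  (splitAt T u)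
  ; M-I   = M-I
  ; α-I   = α-I
  ; M-F   = M-F
  } where open DPN N

IsTau : ∀ T {k} → Pred (Fin (T ℕ.+ k)) 0ℓ
IsTau T u = ∃ λ i → u ≡ T ↑ʳ i

dropτ : ∀ {k} → DPN P (T ℕ.+ k) V → DPN P T V
dropτ {k = k} N = record
  { F⁻    = λ p t → F⁻ p (t ↑ˡ k)
  ; F⁺    = λ p t → F⁺ p (t ↑ˡ k)
  ; guard = λ t → guard (t ↑ˡ k)
  ; M-I   = M-I
  ; α-I   = α-I
  ; M-F   = M-F
  } where open DPN N

withGuards : DPN P T V → (Fin T → Guard V) → DPN P T V
withGuards N g = record N { guard = g }

module _ (N : DPN P T V) (G : CCG N) (Tτ : Pred (Fin T) 0ℓ) where
  open DPN N
  open CCG G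

  CCGArc : Set
  CCGArc = Fin size × Fin T × Fin size

  Critical : Pred CCGArc 0ℓ
  Critical (s , t , s′) = Arc s t s′ × color s ≡ green × color s′ ≡ red

  LastNonTau : List (Fin T) → Fin T → Set
  LastNonTau ts u = ∃₂ λ ts₁ ts₂ → ts ≡ ts₁ ++ u ∷ ts₂ × ¬ Tτ u × All Tτ ts₂

  -- The simple paths leading to s may start at any node r.
  Restricts : CCGArc → Fin T → Set
  Restricts (s , t , s′) u =
      (¬ Tτ t × u ≡ t)
    ⊎ (Tτ t × ∃ λ r → ∃ λ (w : Walk Arc r s) → Unique (vertices w) × LastNonTau (labels w) u)

  record RepairStep : Set where
    field
      restrictions        : Fin T → List CCGArc
      restrictions-unique : ∀ u → Unique (restrictions u)
      restrictions-spec   : ∀ u a → a ∈ restrictions u ⇔ (Critical a × Restricts a u)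

    restrict : Fin T → Guard V → CCGArc → Guard V
    restrict u g (_ , _ , s′) = g ∧′ ¬′ rename (after N u) (constraint s′)

    repaired : DPN P T V
    repaired = withGuards N (λ u → foldl (restrict u) (guard u) (restrictions u))

-- A net together with the identification of its places and transitions with
-- places and transitions of N.
record Result (N : DPN P T V) : Set where
  field
    {P′ T′}     : ℕ
    net         : DPN P′ T′ V
    placeOf     : Fin P′ ↣ Fin P
    transition  : Fin T′ ↣ Fin T

  transitionOf : Fin T′ → Fin T
  transitionOf = Injection.to transition

  -- Removed places hold their initial number of tokens.
  extend : Marking P′ → Marking P
  extend M p with Fin.any? (λ p′ → Injection.to placeOf p′ Fin.≟ p)
  ... | yes (p′ , _) = M p′
  ... | no _         = DPN.M-I N p

  extendState : State P′ V → State P V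
  extendState (M , α) = extend M , α

unmodified : (N : DPN P T V) → Result N
unmodified N = record { net = N ; placeOf = ↣-id _ ; transition = ↣-id _ }

-- Repairing N c o : c is the current net at the beginning of some iteration of
-- the loop, its transition u stemming from the transition o u of N.
data Repairing {P T V : ℕ} (N : DPN P T V) :
               ∀ {T′} → DPN P T′ V → (Fin T′ → Fin T) → Set₁ where
  first : (G : CCG N) (S : RepairStep N G ∅) → Repairing N (RepairStep.repaired S) id
  next  : ∀ {T′ T″} {c : DPN P T′ V} {o : Fin T′ → Fin T} → Repairing N c o →
          {c-R : DPN P T″ V} {r : Fin T″ → Fin T′} → Refinement c c-R r →
          (inputs : Fin T″ → Φ (Fin V)) → (∀ t → IsInputCondition c-R t (inputs t)) →
          (G : CCG (τ-DPN c-R inputs)) → CCG.HasGreen G → CCG.HasRed G →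
          (S : RepairStep (τ-DPN c-R inputs) G (IsTau T″)) →
          Repairing N (dropτ (RepairStep.repaired S)) (o ∘ r)

-- The last step, for the current net c with origins o.
module _ {U} (N : DPN P T V) (c : DPN P U V) (o : Fin U → Fin T) where

  Isolated : Fin P → Set
  Isolated p = ∀ u → ¬ DeadTransition c u → DPN.F⁻ c p u ≡ 0 × DPN.F⁺ c p u ≡ 0

  record Cleanup : Set where
    field
      {P′ T′}         : ℕ
      placeOf         : Fin P′ ↣ Fin P
      placeOf-spec    : ∀ p → (∃ λ p′ → Injection.to placeOf p′ ≡ p) ⇔ (¬ Isolated p)
      transition      : Fin T′ ↣ Fin T
      transition-spec : ∀ t → (∃ λ t′ → Injection.to transition t′ ≡ t)
                              ⇔ (∃ λ u → o u ≡ t × ¬ DeadTransition c u)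
      parts           : Fin T′ → List (Fin U)
      parts-unique    : ∀ t → Unique (parts t)
      parts-spec      : ∀ t u → u ∈ parts t
                              ⇔ (o u ≡ Injection.to transition t × ¬ DeadTransition c u)

      -- Merged transitions share their arcs with each of their parts.
      F⁻ F⁺           : Fin P′ → Fin T′ → ℕ
      F-spec          : ∀ p t u → u ∈ parts t →
                        F⁻ p t ≡ DPN.F⁻ c (Injection.to placeOf p) u ×
                        F⁺ p t ≡ DPN.F⁺ c (Injection.to placeOf p) u

    result : Result N
    result = record
      { net = record
        { F⁻    = F⁻
        ; F⁺    = F⁺
        ; guard = λ t → ⋁ (List.map (DPN.guard c) (parts t))
        ; M-I   = DPN.M-I c ∘ Injection.to placeOf
        ; α-I   = DPN.α-I c
        ; M-F   = DPN.M-F c ∘ Injection.to placeOf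
        }
      ; placeOf    = placeOf
      ; transition = transition
      }

-- RepairDPN N R b : some execution on N returns the net R with isSuccess = b.
data RepairDPN {P T V : ℕ} (N : DPN P T V) : Result N → Bool → Set₁ where
  success : ∀ {T′ T″} {c : DPN P T′ V} {o : Fin T′ → Fin T} → Repairing N c o →
            {c-R : DPN P T″ V} {r : Fin T″ → Fin T′} → Refinement c c-R r →
            (inputs : Fin T″ → Φ (Fin V)) → (∀ t → IsInputCondition c-R t (inputs t)) →
            (G : CCG (τ-DPN c-R inputs)) → CCG.AllGreen G →
            (K : Cleanup N c o) → RepairDPN N (Cleanup.result K) true
  failure : ∀ {T′ T″} {c : DPN P T′ V} {o : Fin T′ → Fin T} → Repairing N c o →
            {c-R : DPN P T″ V} {r : Fin T″ → Fin T′} → Refinement c c-R r →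
            (inputs : Fin T″ → Φ (Fin V)) → (∀ t → IsInputCondition c-R t (inputs t)) →
            (G : CCG (τ-DPN c-R inputs)) → CCG.AllRed G →
            RepairDPN N (unmodified N) false

{-# OPTIONS --safe #-}

-- A repair step and a refinement only ever conjoin guards with further
-- constraints, and these mention vʷ only if the guard already writes v.  So a
-- firing of a copy of t in any intermediate net is a firing of t, frame
-- condition included.  Merging the copies takes the disjunction of guards all
-- of which imply that of t; as this disjunction is the de Morgan one, ⊨ has to
-- be stable under double negation.  A removed place is untouched by every
-- merged transition, so that it keeps its initial number of tokens.
module Submission where

open import Defs
open import Data.Bool.Base using (Bool)
open import Data.Fin.Base using (Fin; _↑ˡ_)
import Data.Fin.Properties as Fin
open import Data.List.Base as List using ([]; _∷_; _++_; allFin; foldl)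
open import Data.List.Membership.Propositional using (_∈_)
open import Data.List.Membership.Propositional.Properties using (∈-++⁻; ∈-lookup; ∈-map⁻)
open import Data.List.Properties using (map-++)
open import Data.List.Relation.Unary.All as All using (All; []; _∷_)
import Data.List.Relation.Unary.All.Properties as All
open import Data.List.Relation.Unary.Any using (Any; here; there)
open import Data.Nat.Base using (ℕ; _≤_; _∸_; _+_; z≤n)
import Data.Nat.Properties as ℕ
open import Data.Product.Base using (∃; _×_; _,_; proj₁; proj₂)
import Data.Rational.Properties as ℚ
open import Data.Sum.Base using ([_,_]; [_,_]′)
open import Function.Base using (id; _∘_)
open import Function.Bundles using (Equivalence; Injection)
open import Relation.Binary.PropositionalEquality
  using (_≡_; refl; sym; trans; cong; cong₂; subst)
open import Relation.Nullary.Decidable using (decidable-stable; yes; no)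
open import Relation.Nullary.Negation using (¬_; Stable; contradiction; negated-stable)

open Equivalence using (to; from)

private variable
  P T U V W : ℕ
  X Y : Set

-- Stability of satisfaction under double negation.

≤ᴿ-stable : ∀ x y → Stable (x ≤ᴿ y)
≤ᴿ-stable x y ¬¬x≤y n = decidable-stable (_ ℚ.≤? _) λ ¬≤ → ¬¬x≤y λ x≤y → ¬≤ (x≤y n)

⟦⟧ᶜ-stable : ∀ ⊙ x y → Stable (⟦ ⊙ ⟧ᶜ x y)
⟦⟧ᶜ-stable lt x y = negated-stable
⟦⟧ᶜ-stable gt x y = negated-stable
⟦⟧ᶜ-stable eq x y ¬¬x≈y =
    ≤ᴿ-stable x y (λ ¬≤ → ¬¬x≈y (¬≤ ∘ proj₁))
  , ≤ᴿ-stable y x (λ ¬≤ → ¬¬x≈y (¬≤ ∘ proj₂))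

-- Strict comparisons and negations are negated statements, equality reduces to decidable
-- inequalities of rationals, and conjunction inherits stability.
⊨-stable : ∀ (θ : X → ℝ) φ → Stable (θ ⊨ φ)
⊨-stable θ ⊤′            _ = _
⊨-stable θ (var x ⊙ y)   = ⟦⟧ᶜ-stable ⊙ (θ x) (θ y)
⊨-stable θ (const x ⊙ c) = ⟦⟧ᶜ-stable ⊙ (θ x) c
⊨-stable θ (¬′ φ)        = negated-stable
⊨-stable θ (φ ∧′ ψ) ¬¬⊨  =
    ⊨-stable θ φ (λ ¬φ → ¬¬⊨ (¬φ ∘ proj₁))
  , ⊨-stable θ ψ (λ ¬ψ → ¬¬⊨ (¬ψ ∘ proj₂))

-- Renaming and disjunction of constraints.

vars-rename : ∀ (f : X → Y) φ → vars (rename f φ) ≡ List.map f (vars φ)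
vars-rename f ⊤′            = refl
vars-rename f (var x ⊙ y)   = refl
vars-rename f (const x ⊙ c) = refl
vars-rename f (¬′ φ)        = vars-rename f φ
vars-rename f (φ ∧′ ψ)      =
  trans (cong₂ _++_ (vars-rename f φ) (vars-rename f ψ)) (sym (map-++ f (vars φ) (vars ψ)))

-- A de Morgan disjunction yields no true disjunct constructively, so it is eliminated
-- contrapositively.
⋁-refutes : ∀ {θ : X → ℝ} {φs} → All (λ φ → ¬ (θ ⊨ φ)) φs → ¬ (θ ⊨ ⋁ φs)
⋁-refutes []               ⊨⋁ = ⊨⋁ _
⋁-refutes (¬φ ∷ [])        ⊨⋁ = ¬φ ⊨⋁
⋁-refutes (¬φ ∷ ¬ψ ∷ ¬φs)  ⊨⋁ = ⊨⋁ (¬φ , ⋁-refutes (¬ψ ∷ ¬φs))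

∈-vars-⋁ : ∀ {x : X} φs → x ∈ vars (⋁ φs) → Any (λ φ → x ∈ vars φ) φs
∈-vars-⋁ (φ ∷ [])     x∈ = here x∈
∈-vars-⋁ (φ ∷ ψ ∷ φs) x∈ = [ here , there ∘ ∈-vars-⋁ (ψ ∷ φs) ]′ (∈-++⁻ (vars φ) x∈)

-- Strengthening of guards.

infix 4 _≼_

-- Entailment alone would not carry a firing over: a variable written by `φ` only could change
-- although the frame condition of `ψ` fixes it.
record _≼_ (φ ψ : Guard V) : Set where
  field
    entails : ∀ {θ} → θ ⊨ φ → θ ⊨ ψ
    writes⊆ : ∀ {v} → v ʷ ∈ vars φ → v ʷ ∈ vars ψ

open _≼_

≼-refl : ∀ {φ : Guard V} → φ ≼ φ
≼-refl = record { entails = id ; writes⊆ = id }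

≼-trans : ∀ {φ ψ χ : Guard V} → φ ≼ ψ → ψ ≼ χ → φ ≼ χ
≼-trans p q = record { entails = entails q ∘ entails p ; writes⊆ = writes⊆ q ∘ writes⊆ p }

-- The writes of `χ` are bounded by those of `ψ` because, along a chain of conjunctions, the
-- renaming refers to the guard at its start.
∧′-≼ : ∀ {φ χ ψ : Guard V} → φ ≼ ψ → (∀ {v} → v ʷ ∈ vars χ → v ʷ ∈ vars ψ) → φ ∧′ χ ≼ ψ
∧′-≼ {φ = φ} φ≼ψ χ⊆ψ = record
  { entails = entails φ≼ψ ∘ proj₁
  ; writes⊆ = [ writes⊆ φ≼ψ , χ⊆ψ ] ∘ ∈-++⁻ (vars φ)
  }

⋁-≼ : ∀ {ψ : Guard V} φs → All (_≼ ψ) φs → ⋁ φs ≼ ψ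
⋁-≼ {ψ = ψ} φs φs≼ψ = record
  -- If `ψ` failed, every disjunct would fail, and with them the disjunction.
  { entails = λ {θ} ⊨⋁ → ⊨-stable θ ψ λ ¬ψ →
      ⋁-refutes (All.map (λ φ≼ψ → ¬ψ ∘ entails φ≼ψ) φs≼ψ) ⊨⋁
  ; writes⊆ = λ v∈ → All.lookupWith (λ φ≼ψ → writes⊆ φ≼ψ) φs≼ψ (∈-vars-⋁ φs v∈)
  }

module _ (N : DPN P T V) (t : Fin T) where
  open DPN N

  after-ʷ : ∀ {x v} → after N t x ≡ v ʷ → Writes N t v
  after-ʷ {x} after≡ with writes? N t x
  after-ʷ refl | yes w = w

  -- `after` chooses an output copy only for variables that `t` writes, so a renamed constraint
  -- cannot extend the write set.
  after-writes : ∀ χ {v} → v ʷ ∈ vars (rename (after N t) χ) → Writes N t v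
  after-writes χ v∈ =
    let _ , _ , v≡ = ∈-map⁻ (after N t) (subst (_ ∈_) (vars-rename (after N t) χ) v∈)
    in after-ʷ (sym v≡)

  -- The current guard `g` is arbitrary, as the recursion passes to the two halves while the bound
  -- stays at the unsplit guard.
  Split-≼ : ∀ {g χs gs} → g ≼ guard t → Split N t g χs gs → All (_≼ guard t) gs
  Split-≼ g≼ []                          = g≼ ∷ []
  Split-≼ g≼ (keep _ s)                  = Split-≼ g≼ s
  Split-≼ g≼ (split {χ = χ} _ _ s⁺ s⁻)   =
    All.++⁺ (Split-≼ (∧′-≼ g≼ (after-writes χ)) s⁺) (Split-≼ (∧′-≼ g≼ (after-writes χ)) s⁻)

-- Nets made of restricted copies of transitions.

record Restricts-to (c : DPN P U V) (N : DPN P T V) (o : Fin U → Fin T) : Set where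
  private
    module c = DPN c
    module N = DPN N
  field
    F⁻-≡   : ∀ p u → c.F⁻ p u ≡ N.F⁻ p (o u)
    F⁺-≡   : ∀ p u → c.F⁺ p u ≡ N.F⁺ p (o u)
    guard≼ : ∀ u → c.guard u ≼ N.guard (o u)
    M-I-≡  : c.M-I ≡ N.M-I
    α-I-≡  : c.α-I ≡ N.α-I

open Restricts-to

Restricts-to-trans : ∀ {d : DPN P W V} {c : DPN P U V} {N : DPN P T V}
                     {r : Fin W → Fin U} {o : Fin U → Fin T} →
                     Restricts-to d c r → Restricts-to c N o → Restricts-to d N (o ∘ r)
Restricts-to-trans {r = r} p q = record
  { F⁻-≡   = λ x u → trans (F⁻-≡ p x u) (F⁻-≡ q x (r u))
  ; F⁺-≡   = λ x u → trans (F⁺-≡ p x u) (F⁺-≡ q x (r u))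
  ; guard≼ = λ u → ≼-trans (guard≼ p u) (guard≼ q (r u))
  ; M-I-≡  = trans (M-I-≡ p) (M-I-≡ q)
  ; α-I-≡  = trans (α-I-≡ p) (α-I-≡ q)
  }

withGuards-restricts : ∀ (N : DPN P T V) {gs} → (∀ t → gs t ≼ DPN.guard N t) →
                       Restricts-to (withGuards N gs) N id
withGuards-restricts N gs≼ = record
  { F⁻-≡ = λ _ _ → refl ; F⁺-≡ = λ _ _ → refl ; guard≼ = gs≼ ; M-I-≡ = refl ; α-I-≡ = refl }

-- The original transitions come first in the τ-DPN, so `splitAt` sends them to the summand that
-- copies `N`.
dropτ-τ-DPN-restricts : ∀ (N : DPN P T V) inputs → Restricts-to (dropτ (τ-DPN N inputs)) N id
dropτ-τ-DPN-restricts {T = T} N inputs = record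
  { F⁻-≡   = λ p t → cong [ DPN.F⁻ N p , _ ] (Fin.splitAt-↑ˡ T t (#τ N))
  ; F⁺-≡   = λ p t → cong [ DPN.F⁺ N p , _ ] (Fin.splitAt-↑ˡ T t (#τ N))
  ; guard≼ = λ t → subst (_≼ DPN.guard N t)
                     (sym (cong [ DPN.guard N , _ ] (Fin.splitAt-↑ˡ T t (#τ N)))) ≼-refl
  ; M-I-≡  = refl
  ; α-I-≡  = refl
  }

-- Repair steps in the loop act on the τ-DPN; this compares their effect once the τ-transitions are
-- gone.
dropτ-mono : ∀ {k} {c N : DPN P (T + k) V} →
             Restricts-to c N id → Restricts-to (dropτ {k = k} c) (dropτ {k = k} N) id
dropτ-mono {k = k} p = record
  { F⁻-≡   = λ x t → F⁻-≡ p x (t ↑ˡ k)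
  ; F⁺-≡   = λ x t → F⁺-≡ p x (t ↑ˡ k)
  ; guard≼ = λ t → guard≼ p (t ↑ˡ k)
  ; M-I-≡  = M-I-≡ p
  ; α-I-≡  = α-I-≡ p
  }

repaired-restricts : ∀ {N : DPN P T V} {G : CCG N} {Tτ} (S : RepairStep N G Tτ) →
                     Restricts-to (RepairStep.repaired S) N id
repaired-restricts {N = N} {G} S =
  withGuards-restricts N λ u → foldl-≼ u (restrictions u) ≼-refl
  where
  open DPN N
  open RepairStep S

  foldl-≼ : ∀ u as {g} → g ≼ guard u → foldl (restrict u) g as ≼ guard u
  foldl-≼ u []                 g≼ = g≼
  foldl-≼ u ((_ , _ , s′) ∷ as) g≼ =
    foldl-≼ u as (∧′-≼ g≼ (after-writes N u (CCG.constraint G s′)))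

refined-restricts : ∀ {N : DPN P T V} (R : RefinementPass N) →
                    Restricts-to (RefinementPass.refined R) N (RefinementPass.origin R)
refined-restricts {T = T} {N = N} R = record
  { F⁻-≡   = λ _ _ → refl
  ; F⁺-≡   = λ _ _ → refl
  ; guard≼ = λ u → All.lookup copies-≼ (∈-lookup u)
  ; M-I-≡  = refl
  ; α-I-≡  = refl
  }
  where
  open RefinementPass R

  copies-≼ : All (λ (t , g) → g ≼ DPN.guard N t) copies
  copies-≼ = All.concat⁺ (All.map⁺ (All.universal
    (λ t → All.map⁺ (Split-≼ N t ≼-refl (guards-spec t))) (allFin T)))

Refinement-restricts : ∀ {N : DPN P T V} {N-R : DPN P U V} {o} →
                       Refinement N N-R o → Restricts-to N-R N o
-- Record eta identifies `N` with `withGuards` applied to its own guards.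
Refinement-restricts {N = N} (done _ _)     = withGuards-restricts N λ _ → ≼-refl
Refinement-restricts         (more R _ ref) =
  Restricts-to-trans (Refinement-restricts ref) (refined-restricts R)

Repairing-restricts : ∀ {N : DPN P T V} {c : DPN P U V} {o} →
                      Repairing N c o → Restricts-to c N o
Repairing-restricts (first _ S) = repaired-restricts S
Repairing-restricts (next rep {c-R = c-R} ref inputs _ _ _ _ S) =
  -- From the newest net back to `N`: the repair step, the added τ-transitions, the refinement, the
  -- earlier iterations.
  Restricts-to-trans (dropτ-mono (repaired-restricts S))
  (Restricts-to-trans (dropτ-τ-DPN-restricts c-R inputs)
  (Restricts-to-trans (Refinement-restricts ref) (Repairing-restricts rep)))

-- Embedding of the returned net into the source net.

record Embeds {N : DPN P T V} (R : Result N) : Set where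
  open Result R
  module N = DPN N
  module R = DPN net

  place : Fin P′ → Fin P
  place = Injection.to placeOf

  field
    F⁻-kept    : ∀ p t → R.F⁻ p t ≡ N.F⁻ (place p) (transitionOf t)
    F⁺-kept    : ∀ p t → R.F⁺ p t ≡ N.F⁺ (place p) (transitionOf t)
    F-removed  : ∀ p t → ¬ (∃ λ p′ → place p′ ≡ p) →
                 N.F⁻ p (transitionOf t) ≡ 0 × N.F⁺ p (transitionOf t) ≡ 0
    guard-≼    : ∀ t → R.guard t ≼ N.guard (transitionOf t)
    M-I-kept   : ∀ p → R.M-I p ≡ N.M-I (place p)
    α-I-kept   : R.α-I ≡ N.α-I

module _ {N : DPN P T V} {R : Result N} (E : Embeds R) where
  open Result R
  open Embeds E

  extend-M-I : ∀ {M} → M ≗ᴹ R.M-I → extend M ≗ᴹ N.M-I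
  extend-M-I M≗ p with Fin.any? (λ p′ → place p′ Fin.≟ p)
  ... | yes (p′ , refl) = trans (M≗ p′) (M-I-kept p′)
  ... | no _            = refl

  extend-Moves : ∀ {M t M′} → Moves net M t M′ → Moves N (extend M) (transitionOf t) (extend M′)
  extend-Moves {M} {t} {M′} (enough , moves) = enough′ , moves′
    where
    enough′ : ∀ p → N.F⁻ p (transitionOf t) ≤ extend M p
    enough′ p with Fin.any? (λ p′ → place p′ Fin.≟ p)
    ... | yes (p′ , refl) rewrite sym (F⁻-kept p′ t)          = enough p′
    ... | no removed      rewrite proj₁ (F-removed p t removed) = z≤n

    moves′ : ∀ p → extend M′ p ≡ extend M p ∸ N.F⁻ p (transitionOf t)
                                   + N.F⁺ p (transitionOf t)
    moves′ p with Fin.any? (λ p′ → place p′ Fin.≟ p)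
    ... | yes (p′ , refl) rewrite sym (F⁻-kept p′ t) | sym (F⁺-kept p′ t) = moves p′
    -- Both arc weights are 0 here, so the initial count has to equal itself minus 0 plus 0.
    ... | no removed rewrite proj₁ (F-removed p t removed) | proj₂ (F-removed p t removed) =
      sym (ℕ.+-identityʳ (N.M-I p))

  extend-Fires : ∀ {s t s′} → Fires net s t s′ →
                 Fires N (extendState s) (transitionOf t) (extendState s′)
  extend-Fires {t = t} (moves , ⊨guard , frame) =
    -- The frame condition is contravariant in the write set: what the source transition does not
    -- write, the merged one does not write either.
    extend-Moves moves , entails (guard-≼ t) ⊨guard , λ v ¬w → frame v (¬w ∘ writes⊆ (guard-≼ t))

  extend-Reach : ∀ {s} → Reach net s → Reach N (extendState s)
  extend-Reach (initial {α = α} M≗ α≈) =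
    initial (extend-M-I M≗) (subst (α ≈ⱽ_) α-I-kept α≈)
  extend-Reach (fire r f) = fire (extend-Reach r) (extend-Fires f)

  Embeds⇒SubgraphVia : SubgraphVia extendState transitionOf (RG net) (RG N)
  Embeds⇒SubgraphVia = record
    { nodes⊆ = extend-Reach
    ; edges⊆ = λ (r , r′ , f) → extend-Reach r , extend-Reach r′ , extend-Fires f
    }

unmodified-embeds : ∀ (N : DPN P T V) → Embeds (unmodified N)
unmodified-embeds N = record
  { F⁻-kept   = λ _ _ → refl
  ; F⁺-kept   = λ _ _ → refl
  -- The identity hits every place, so none is removed.
  ; F-removed = λ p _ removed → contradiction (p , refl) removed
  ; guard-≼   = λ _ → ≼-refl
  ; M-I-kept  = λ _ → refl
  ; α-I-kept  = refl
  }

-- Removal of places and merging of transitions.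

Cleanup-embeds : ∀ {N : DPN P T V} {c : DPN P U V} {o} → Restricts-to c N o →
                 (K : Cleanup N c o) → Embeds (Cleanup.result K)
Cleanup-embeds {N = N} {c} {o} c≼N K = record
  { F⁻-kept   = λ p t → let u , u∈ , ou≡ , _ = part t in
      trans (proj₁ (F-spec p t u u∈)) (F⁻-via ou≡)
  ; F⁺-kept   = λ p t → let u , u∈ , ou≡ , _ = part t in
      trans (proj₂ (F-spec p t u u∈)) (F⁺-via ou≡)
  ; F-removed = λ p t removed →
      let u , _ , ou≡ , ¬dead = part t
          -- The specification of kept places only refutes non-isolation; decidability of equality
          -- with 0 then removes the double negation.
          ¬¬isolated = λ ¬isolated → removed (from (placeOf-spec p) ¬isolated)
      in trans (sym (F⁻-via ou≡))
           (decidable-stable (_ ℕ.≟ 0) λ ≢0 → ¬¬isolated λ iso → ≢0 (proj₁ (iso u ¬dead)))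
       , trans (sym (F⁺-via ou≡))
           (decidable-stable (_ ℕ.≟ 0) λ ≢0 → ¬¬isolated λ iso → ≢0 (proj₂ (iso u ¬dead)))
  ; guard-≼   = λ t → ⋁-≼ _ (All.map⁺ (All.tabulate λ {u} u∈ →
      subst (λ t′ → DPN.guard c u ≼ DPN.guard N t′)
        (proj₁ (to (parts-spec t u) u∈)) (guard≼ c≼N u)))
  ; M-I-kept  = λ p → cong (λ M → M (Injection.to placeOf p)) (M-I-≡ c≼N)
  ; α-I-kept  = α-I-≡ c≼N
  }
  where
  open Cleanup K

  -- A transition survives only through some part that is not dead; its arcs are those of that part,
  -- hence those of its origin.
  part : ∀ t → ∃ λ u → u ∈ parts t × o u ≡ Injection.to transition t × ¬ DeadTransition c u
  part t = let u , spec = to (transition-spec _) (t , refl) in u , from (parts-spec t u) spec , spec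

  F⁻-via : ∀ {p u t} → o u ≡ t → DPN.F⁻ c p u ≡ DPN.F⁻ N p t
  F⁻-via refl = F⁻-≡ c≼N _ _

  F⁺-via : ∀ {p u t} → o u ≡ t → DPN.F⁺ c p u ≡ DPN.F⁺ N p t
  F⁺-via refl = F⁺-≡ c≼N _ _

proposition4p5 : ∀ {P T V : ℕ} (N : DPN P T V) (N-Rep : Result N) (isSuccess : Bool) →
    RepairDPN N N-Rep isSuccess →
    SubgraphVia (Result.extendState N-Rep) (Result.transitionOf N-Rep) (RG (Result.net N-Rep)) (RG N)
proposition4p5 N _ _ (success rep _ _ _ _ _ K) =
  Embeds⇒SubgraphVia (Cleanup-embeds (Repairing-restricts rep) K)
proposition4p5 N _ _ (failure _ _ _ _ _ _) = Embeds⇒SubgraphVia (unmodified-embeds N)
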